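{- Let $G$ be a cactus graph on $n\geq 4$ vertices with at least two cycles. Then $n-4\leq \operatorname{Z}(\overline{G})\leq n-2$. Furthermore: (1) $\operatorname{Z}(\overline{G})=n-2$ if and only if $G$ is obtained from the star $K_{1,n-1}$ by adding at least two pairwise vertex-disjoint edges between leaves; (2) $\operatorname{Z}(\overline{G})=n-4$ if and only if $G$ contains a $4$-cycle $C$ having two adjacent vertices each of which has a neighbor not on $C$; (3) $\operatorname{Z}(\overline{G})=n-3$ otherwise.
   Context: All graphs are finite, simple and undirected. A cactus graph is a connected graph in which any two simple cycles have at most one vertex in common. $K_{1,n-1}$ is the star on $n$ vertices. $\overline{G}$ denotes the complement of $G$ (same vertex set; distinct vertices adjacent iff not adjacent in $G$). Zero forcing: given an initial set $B\subseteq V(G)$ of blue vertices (all others white), a blue vertex with exactly one white neighbor may turn that neighbor blue; $B$ is a zero forcing set if repeated application makes all vertices blue. $\operatorname{Z}(G)$ is the minimum size of a zero forcing set of $G$. -}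

module Defs where

open import Data.Nat using (ℕ; zero; suc; _+_; _≤_; _∸_)
open import Data.Fin using (Fin; toℕ; _≟_)
open import Data.Fin.Subset using (Subset; _∈_; ∣_∣)
open import Data.Bool using (Bool; true; false; not; if_then_else_)
open import Data.Product using (Σ; ∃; ∃-syntax; _×_; _,_)
open import Data.Sum using (_⊎_)
open import Relation.Nullary using (¬_; yes; no)
open import Relation.Binary.PropositionalEquality using (_≡_; _≢_; refl)
open import Data.Empty using (⊥-elim)

record Graph (n : ℕ) : Set where
  field
    adj   : Fin n → Fin n → Bool
    adj-sym : ∀ u v → adj u v ≡ adj v u
    adj-irref : ∀ v → adj v v ≡ false
open Graph public

E : ∀ {n} → Graph n → Fin n → Fin n → Set
E G u v = adj G u v ≡ true

compl-adj : ∀ {n} → Graph n → Fin n → Fin n → Bool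
compl-adj G u v with u ≟ v
... | yes _ = false
... | no _  = not (adj G u v)

compl-sym : ∀ {n} (G : Graph n) u v → compl-adj G u v ≡ compl-adj G v u
compl-sym G u v with u ≟ v | v ≟ u
... | yes _ | yes _ = refl
... | yes refl | no q = ⊥-elim (q refl)
... | no p | yes refl = ⊥-elim (p refl)
... | no _ | no _ rewrite adj-sym G u v = refl

compl-irref : ∀ {n} (G : Graph n) v → compl-adj G v v ≡ false
compl-irref G v with v ≟ v
... | yes _ = refl
... | no p = ⊥-elim (p refl)

complement : ∀ {n} → Graph n → Graph n
complement G = record { adj = compl-adj G ; adj-sym = compl-sym G ; adj-irref = compl-irref G }

data Reach {n} (G : Graph n) : Fin n → Fin n → Set where
  here : ∀ {v} → Reach G v v
  step : ∀ {u w v} → E G u w → Reach G w v → Reach G u v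

Connected : ∀ {n} → Graph n → Set
Connected G = ∀ u v → Reach G u v

Consec : (k : ℕ) → Fin k → Fin k → Set
Consec k i j = (toℕ j ≡ suc (toℕ i)) ⊎ ((suc (toℕ i) ≡ k) × (toℕ j ≡ 0))

record Cycle {n} (G : Graph n) : Set where
  field
    len     : ℕ
    len≥3   : 3 ≤ len
    vert    : Fin len → Fin n
    inj     : ∀ i j → vert i ≡ vert j → i ≡ j
    closed  : ∀ i j → Consec len i j → E G (vert i) (vert j)
open Cycle public

OnCycle : ∀ {n} {G : Graph n} → Cycle G → Fin n → Set
OnCycle C u = ∃[ i ] (vert C i ≡ u)

CycleEdge : ∀ {n} {G : Graph n} → Cycle G → Fin n → Fin n → Set
CycleEdge C u v = ∃[ i ] ∃[ j ] (Consec (len C) i j ×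
                    (((vert C i ≡ u) × (vert C j ≡ v)) ⊎ ((vert C i ≡ v) × (vert C j ≡ u))))

SameCycle : ∀ {n} {G : Graph n} → Cycle G → Cycle G → Set
SameCycle C D = ∀ u v → (CycleEdge C u v → CycleEdge D u v) × (CycleEdge D u v → CycleEdge C u v)

Cactus : ∀ {n} → Graph n → Set
Cactus G = Connected G ×
  (∀ (C D : Cycle G) → ¬ SameCycle C D →
     ∀ u v → OnCycle C u → OnCycle D u → OnCycle C v → OnCycle D v → u ≡ v)

AtLeastTwoCycles : ∀ {n} → Graph n → Set
AtLeastTwoCycles G = Σ (Cycle G) λ C → Σ (Cycle G) λ D → ¬ SameCycle C D

-- Zero forcing: the set of vertices eventually blue from the initial set B,
-- i.e. the least set containing B closed under the colour-change rule
-- (a blue vertex u all of whose neighbours other than v are blue forces v).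
data Blue {n} (G : Graph n) (B : Subset n) : Fin n → Set where
  init  : ∀ {v} → v ∈ B → Blue G B v
  force : ∀ {u v} → Blue G B u → E G u v →
          (∀ w → E G u w → w ≢ v → Blue G B w) → Blue G B v

ZeroForcingSet : ∀ {n} → Graph n → Subset n → Set
ZeroForcingSet G B = ∀ v → Blue G B v

IsZ : ∀ {n} → Graph n → ℕ → Set
IsZ {n} G k = (Σ (Subset n) λ B → (∣ B ∣ ≡ k) × ZeroForcingSet G B)
            × (∀ B → ZeroForcingSet G B → k ≤ ∣ B ∣)

-- (1) G is K_{1,n-1} with centre c plus at least two pairwise vertex-disjoint
-- edges between leaves: c is adjacent to every other vertex, the edges among
-- leaves form a matching (each leaf has at most one leaf-neighbour), and
-- there are at least two such edges.
StarPlusMatching : ∀ {n} → Graph n → Set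
StarPlusMatching {n} G = Σ (Fin n) λ c →
    (∀ v → v ≢ c → E G c v)
  × (∀ v w w' → v ≢ c → w ≢ c → w' ≢ c → E G v w → E G v w' → w ≡ w')
  × (Σ (Fin n) λ a → Σ (Fin n) λ b → Σ (Fin n) λ a' → Σ (Fin n) λ b' →
       a ≢ c × b ≢ c × a' ≢ c × b' ≢ c ×
       E G a b × E G a' b' ×
       a ≢ a' × a ≢ b' × b ≢ a' × b ≢ b')

FourCycleCond : ∀ {n} → Graph n → Set
FourCycleCond {n} G = Σ (Cycle G) λ C → (len C ≡ 4) ×
  (Σ (Fin (len C)) λ i → Σ (Fin (len C)) λ j →
     E G (vert C i) (vert C j) ×
     (Σ (Fin n) λ x → ¬ OnCycle C x × E G (vert C i) x) ×
     (Σ (Fin n) λ y → ¬ OnCycle C y × E G (vert C j) y))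

{-# OPTIONS --safe #-}
module Submission where

-- Zero forcing in the complement, read in G itself: a run that colours v₁ , … , vₘ in this
-- order, with vᵢ forced by uᵢ, is a sequence with uᵢ ≠ vᵢ, uᵢ ≁ vᵢ, and uᵢ ∼ vⱼ for i < j.
-- Hence Z(complement G) = n − m for the largest length m of such a sequence ("chain").
-- A chain of length 5 puts three common neighbours v₃ , v₄ , v₅ on u₁ and u₂, which a cactus
-- forbids.  A chain of length 4 contains the 4-cycle u₁ v₄ u₂ v₃, where u₁ has the further
-- neighbour v₂ and v₄ the further neighbour u₃; conversely such a 4-cycle gives a chain.
-- A chain of length 3 is a path u₂ v₃ u₁ v₂ with u₂ ≁ v₂ and neither v₃ nor u₁ adjacent to
-- all other vertices.  If no vertex is adjacent to all others, such a path enters a cycle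
-- from outside and follows two of its edges; if some vertex is, then G is a star plus a
-- matching and there is none.

open import Defs
open import Data.Nat using (ℕ; zero; suc; _+_; _≤_; _<_; _∸_; z≤n; s≤s; _<?_)
open import Data.Nat.Properties using (≤-refl; ≤-reflexive; ≤-trans; ≤-antisym; ≮⇒≥; <⇒≱; +-suc; +-identityʳ; m≢1+n+m; +-monoˡ-≤; m≤m+n; m≤n+m; m+n≤o⇒n≤o; m+n≤o⇒m≤o∸n; m≤o∸n⇒m+n≤o; n≤1+n)
open import Data.Bool using (true)
open import Data.Bool.Properties using (¬-not; not-¬)
import Data.Bool.Properties as Bool
open import Data.Fin using (Fin; zero; suc; toℕ; fromℕ<; _≟_)
open import Data.Fin.Properties using (any?; all?; ¬∀⟶∃¬; toℕ-injective; toℕ<n; toℕ-fromℕ<)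
open import Data.Fin.Subset using (Subset; inside; outside; _∈_; _∉_; _⊆_; _∪_; _-_; ⁅_⁆; ⊤; ∣_∣)
open import Data.Fin.Subset.Properties using (_∈?_; ∈⊤; ∣⊤∣≡n; ∪-identityʳ; p⊆p∪q; q⊆p∪q; x∈⁅x⁆; p⊆q⇒∣p∣≤∣q∣; x∈p∧x≢y⇒x∈p-y; x∈p⇒∣p-x∣<∣p∣)
open import Data.Vec using (Vec; []; _∷_; lookup)
open import Data.Vec.Relation.Unary.All as All using (All; []; _∷_)
open import Data.Vec.Relation.Unary.AllPairs as AllPairs using (AllPairs; []; _∷_)
open import Data.Vec.Relation.Unary.Unique.Propositional.Properties using (lookup-injective)
open import Data.Product using (Σ; ∃; ∃₂; _×_; _,_; proj₁; proj₂)
open import Data.Sum using (inj₁; inj₂)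
open import Function using (_∘_; case_of_)
open import Function.Bundles using (_⇔_; mk⇔)
open import Relation.Nullary using (¬_; Dec; yes; no; contradiction; ¬?)
open import Relation.Nullary.Decidable using (map′; _×-dec_; _→-dec_; decidable-stable)
open import Relation.Unary using (Pred; Decidable)
open import Relation.Binary.PropositionalEquality using (_≡_; _≢_; refl; sym; trans; cong; subst)

-- Finite subsets and exhaustive search.

∣p∪⁅x⁆∣≤1+∣p∣ : ∀ {n} (p : Subset n) x → ∣ p ∪ ⁅ x ⁆ ∣ ≤ suc ∣ p ∣
∣p∪⁅x⁆∣≤1+∣p∣ (inside  ∷ p) zero    rewrite ∪-identityʳ p = n≤1+n _
∣p∪⁅x⁆∣≤1+∣p∣ (outside ∷ p) zero    rewrite ∪-identityʳ p = ≤-refl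
∣p∪⁅x⁆∣≤1+∣p∣ (inside  ∷ p) (suc x) = s≤s (∣p∪⁅x⁆∣≤1+∣p∣ p x)
∣p∪⁅x⁆∣≤1+∣p∣ (outside ∷ p) (suc x) = ∣p∪⁅x⁆∣≤1+∣p∣ p x

∣p∣<n⇒∃∉ : ∀ {n} (p : Subset n) → ∣ p ∣ < n → ∃ λ x → x ∉ p
∣p∣<n⇒∃∉ {n} p ∣p∣<n = ¬∀⟶∃¬ n (_∈ p) (_∈? p) λ all∈ →
  <⇒≱ ∣p∣<n (subst (_≤ ∣ p ∣) (∣⊤∣≡n n) (p⊆q⇒∣p∣≤∣q∣ {p = ⊤} {q = p} (λ {x} _ → all∈ x)))

-- The search is taken at every level because it is applied to a predicate that itself quantifies
-- over the remaining entries.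
anyVec? : ∀ {a} {A : Set a} → (∀ {ℓ} {P : Pred A ℓ} → Decidable P → Dec (∃ P)) →
          ∀ {ℓ m} {P : Pred (Vec A m) ℓ} → Decidable P → Dec (∃ P)
anyVec? search {m = zero}  P? = map′ (λ p → [] , p) (λ { ([] , p) → p }) (P? [])
anyVec? search {m = suc m} P? =
  map′ (λ { (x , xs , p) → x ∷ xs , p }) (λ { (x ∷ xs , p) → x , xs , p })
       (search λ x → anyVec? search λ xs → P? (x ∷ xs))

-- Forcing steps in an arbitrary graph.

module _ {n : ℕ} (H : Graph n) where

  -- Descend the derivation through premises outside S; where none is left, the force can be made from S.
  force-out : ∀ {B v} (S : Subset n) → B ⊆ S → Blue H B v → v ∉ S →
              ∃₂ λ u w → u ∈ S × w ∉ S × E H u w × (∀ x → E H u x → x ≢ w → x ∈ S)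
  force-out S B⊆S (init v∈B) v∉S = contradiction (B⊆S v∈B) v∉S
  force-out S B⊆S (force {u} {v} bu uv others) v∉S with u ∈? S
  ... | no u∉S = force-out S B⊆S bu u∉S
  ... | yes u∈S with any? (λ x → (adj H u x Bool.≟ true) ×-dec ¬? (x ≟ v) ×-dec ¬? (x ∈? S))
  ...   | yes (x , ux , x≢v , x∉S) = force-out S B⊆S (others x ux x≢v) x∉S
  ...   | no none = u , v , u∈S , v∉S , uv ,
          λ x ux x≢v → decidable-stable (x ∈? S) λ x∉S → none (x , ux , x≢v , x∉S)

  Blue-trans : ∀ {B B′} → (∀ {v} → v ∈ B → Blue H B′ v) → ∀ {v} → Blue H B v → Blue H B′ v
  Blue-trans B⇒ (init v∈B) = B⇒ v∈B
  Blue-trans B⇒ (force bu uv others) =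
    force (Blue-trans B⇒ bu) uv λ w uw w≢v → Blue-trans B⇒ (others w uw w≢v)

-- Cyclic successors of positions.

Consec-functional : ∀ {k} {i j j′ : Fin k} → Consec k i j → Consec k i j′ → j ≡ j′
Consec-functional (inj₁ p) (inj₁ q) = toℕ-injective (trans p (sym q))
Consec-functional {j = j} (inj₁ p) (inj₂ (q , _)) =
  contradiction (≤-reflexive (trans (sym q) (sym p))) (<⇒≱ (toℕ<n j))
Consec-functional {j′ = j′} (inj₂ (p , _)) (inj₁ q) =
  contradiction (≤-reflexive (trans (sym p) (sym q))) (<⇒≱ (toℕ<n j′))
Consec-functional (inj₂ (_ , p)) (inj₂ (_ , q)) = toℕ-injective (trans p (sym q))

next : ∀ {k} (i : Fin k) → ∃ (Consec k i)
next {suc k} i with suc (toℕ i) <? suc k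
... | yes lt = fromℕ< lt , inj₁ (toℕ-fromℕ< lt)
... | no  ge = zero , inj₂ (≤-antisym (toℕ<n i) (≮⇒≥ ge) , refl)

-- Two steps without wrap-around raise the index by two; returning with one wrap-around would force
-- `k` to be 2, with two wrap-arounds 1.
Consec²-irreflexive : ∀ {k} {i j l : Fin k} → 3 ≤ k → Consec k i j → Consec k j l → i ≢ l
Consec²-irreflexive {i = i} _ (inj₁ p) (inj₁ q) refl =
  m≢1+n+m (toℕ i) (trans q (cong suc p))
Consec²-irreflexive 3≤k (inj₁ p) (inj₂ (q , r)) refl rewrite r | p | sym q = contradiction 3≤k λ { (s≤s (s≤s ())) }
Consec²-irreflexive 3≤k (inj₂ (p , q)) (inj₁ r) refl rewrite q | r | sym p = contradiction 3≤k λ { (s≤s (s≤s ())) }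
Consec²-irreflexive 3≤k (inj₂ (p , q)) (inj₂ (r , _)) refl rewrite q | sym r = contradiction 3≤k λ { (s≤s ()) }

-- Adjacency in a graph and in its complement.

module _ {n : ℕ} (G : Graph n) where

  E-sym : ∀ {u v} → E G u v → E G v u
  E-sym {u} {v} uv = trans (adj-sym G v u) uv

  E⇒≢ : ∀ {u v} → E G u v → u ≢ v
  E⇒≢ {u} uu refl with () ← trans (sym uu) (adj-irref G u)

  E? : ∀ u v → Dec (E G u v)
  E? u v = adj G u v Bool.≟ true

  -- With its mirror image, the source of most inequalities between chain vertices: each u is
  -- adjacent to every later v but not to its own.
  neighbour-distinctˡ : ∀ {u u′ v} → E G u v → ¬ E G u′ v → u ≢ u′
  neighbour-distinctˡ uv ¬u′v refl = ¬u′v uv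

  neighbour-distinctʳ : ∀ {u v v′} → E G u v → ¬ E G u v′ → v ≢ v′
  neighbour-distinctʳ uv ¬uv′ refl = ¬uv′ uv

  complement⁻ : ∀ {u v} → E (complement G) u v → u ≢ v × ¬ E G u v
  complement⁻ {u} {v} e with u ≟ v
  ... | no u≢v = u≢v , λ uv → not-¬ (sym uv) (sym e)

  complement⁺ : ∀ {u v} → u ≢ v → ¬ E G u v → E (complement G) u v
  complement⁺ {u} {v} u≢v ¬uv with u ≟ v
  ... | yes u≡v = contradiction u≡v u≢v
  ... | no _ = sym (¬-not (¬uv ∘ sym))

  -- Chains and zero forcing sets of the complement.

  NonEdge : Fin n × Fin n → Set
  NonEdge (u , v) = u ≢ v × ¬ E G u v

  Before : Fin n × Fin n → Fin n × Fin n → Set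
  Before (u , _) (_ , v) = E G u v

  IsChain : ∀ {m} → Vec (Fin n × Fin n) m → Set
  IsChain ps = All NonEdge ps × AllPairs Before ps

  Chain : ℕ → Set
  Chain m = Σ (Vec (Fin n × Fin n) m) IsChain

  -- Lets the final case distinction branch on `Chain 4` constructively.
  Chain? : ∀ m → Dec (Chain m)
  Chain? m = anyVec? anyPair? λ ps →
    All.all? (λ { (u , v) → ¬? (u ≟ v) ×-dec ¬? (E? u v) }) ps
      ×-dec AllPairs.allPairs? (λ { (u , _) (_ , v) → E? u v }) ps
    where
      anyPair? : ∀ {ℓ} {P : Pred (Fin n × Fin n) ℓ} → Decidable P → Dec (∃ P)
      anyPair? P? = map′ (λ { (u , v , p) → (u , v) , p }) (λ { ((u , v) , p) → u , v , p })
                         (any? λ u → any? λ v → P? (u , v))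

  Chain-tail : ∀ {m} → Chain (suc m) → Chain m
  Chain-tail (_ ∷ ps , _ ∷ nes , _ ∷ befs) = ps , nes , befs

  -- While `S` is not everything, some force leaves it; perform it and continue from `S ∪ ⁅ v ⁆`.
  -- All later targets lie outside that set, and `v` was the only complement-neighbour of `u`
  -- outside `S`, so `u` is adjacent to them in `G`.
  ZeroForcingSet⇒Chain : ∀ {B} → ZeroForcingSet (complement G) B → ∀ {m} → ∣ B ∣ + m ≤ n → Chain m
  ZeroForcingSet⇒Chain {B} zf {m} le = let ps , chain , _ = run m B (λ v∈B → v∈B) le in ps , chain
    where
      run : ∀ m (S : Subset n) → B ⊆ S → ∣ S ∣ + m ≤ n →
            Σ (Vec (Fin n × Fin n) m) λ ps → IsChain ps × All (λ p → proj₂ p ∉ S) ps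
      run zero S B⊆S le = [] , ([] , []) , []
      run (suc m) S B⊆S le
        with x , x∉S ← ∣p∣<n⇒∃∉ S (≤-trans (s≤s (m≤m+n ∣ S ∣ m)) (subst (_≤ n) (+-suc ∣ S ∣ m) le))
        with u , v , u∈S , v∉S , uv , others ← force-out (complement G) S B⊆S (zf x) x∉S
        with ps , (nes , befs) , ps∉ ← run m (S ∪ ⁅ v ⁆) (λ b → p⊆p∪q ⁅ v ⁆ (B⊆S b))
               (≤-trans (+-monoˡ-≤ m (∣p∪⁅x⁆∣≤1+∣p∣ S v)) (subst (_≤ n) (+-suc ∣ S ∣ m) le))
        = (u , v) ∷ ps , (complement⁻ uv ∷ nes , All.map (λ {p} → before {p}) ps∉ ∷ befs) ,
          v∉S ∷ All.map (λ p∉ p∈S → p∉ (p⊆p∪q ⁅ v ⁆ p∈S)) ps∉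
        where
          before : ∀ {p} → proj₂ p ∉ S ∪ ⁅ v ⁆ → Before (u , v) p
          before {_ , w} w∉ = decidable-stable (E? u w) λ ¬uw →
            w∉ (p⊆p∪q ⁅ v ⁆ (others w
              (complement⁺ (λ { refl → w∉ (p⊆p∪q ⁅ v ⁆ u∈S) }) ¬uw)
              (λ { refl → w∉ (q⊆p∪q S ⁅ v ⁆ (x∈⁅x⁆ v)) })))

  unforced : ∀ {m} → Vec (Fin n × Fin n) m → Subset n
  unforced [] = ⊤
  unforced ((_ , v) ∷ ps) = unforced ps - v

  ∈-unforced : ∀ {m} {ps : Vec (Fin n × Fin n) m} {x} → All (λ p → x ≢ proj₂ p) ps → x ∈ unforced ps
  ∈-unforced [] = ∈⊤
  ∈-unforced (x≢v ∷ x≢) = x∈p∧x≢y⇒x∈p-y (∈-unforced x≢) x≢v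

  -- Each removal lowers the cardinality, because `v` is not a later target: `u` is adjacent to all
  -- of those but not to `v`.
  IsChain⇒∣unforced∣ : ∀ {m} (ps : Vec (Fin n × Fin n) m) → IsChain ps → ∣ unforced ps ∣ + m ≤ n
  IsChain⇒∣unforced∣ [] _ = ≤-reflexive (trans (+-identityʳ _) (∣⊤∣≡n n))
  IsChain⇒∣unforced∣ {suc m} ((u , v) ∷ ps) ((_ , ¬uv) ∷ nes , befs ∷ befss) =
    subst (_≤ n) (sym (+-suc _ m))
      (≤-trans (+-monoˡ-≤ m (x∈p⇒∣p-x∣<∣p∣ (∈-unforced (All.map (λ uw → neighbour-distinctʳ uw ¬uv ∘ sym) befs))))
               (IsChain⇒∣unforced∣ ps (nes , befss)))

  -- The head of the chain forces first. All later targets are adjacent to `u` in `G`, so `v` is its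
  -- only white neighbour in the complement; once `v` is blue, the set for the tail is blue.
  IsChain⇒ZeroForcingSet : ∀ {m} (ps : Vec (Fin n × Fin n) m) → IsChain ps →
                           ZeroForcingSet (complement G) (unforced ps)
  IsChain⇒ZeroForcingSet [] _ x = init ∈⊤
  IsChain⇒ZeroForcingSet ((u , v) ∷ ps) ((u≢v , ¬uv) ∷ nes , befs ∷ befss) x =
    Blue-trans (complement G) blue (IsChain⇒ZeroForcingSet ps (nes , befss) x)
    where
      v-blue : Blue (complement G) (unforced ((u , v) ∷ ps)) v
      v-blue = force (init (∈-unforced {ps = (u , v) ∷ ps} (u≢v ∷ All.map E⇒≢ befs))) (complement⁺ u≢v ¬uv)
        λ w uw w≢v → init (∈-unforced {ps = (u , v) ∷ ps} (w≢v ∷ All.map (λ uw′ → neighbour-distinctʳ uw′ (proj₂ (complement⁻ uw)) ∘ sym) befs))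

      blue : ∀ {y} → y ∈ unforced ps → Blue (complement G) (unforced ((u , v) ∷ ps)) y
      blue {y} y∈ with y ≟ v
      ... | yes refl = v-blue
      ... | no y≢v = init (x∈p∧x≢y⇒x∈p-y y∈ y≢v)

  -- A zero forcing set with fewer than `n ∸ m` vertices would yield a chain of length `suc m`. The
  -- same bound makes the size of `unforced ps` exact.
  longest-Chain⇒IsZ : ∀ {m} → Chain m → ¬ Chain (suc m) → IsZ (complement G) (n ∸ m)
  longest-Chain⇒IsZ {m} (ps , chain) maximal =
    (unforced ps , ≤-antisym (m+n≤o⇒m≤o∸n _ size) (lower _ zf) , zf) , lower
    where
      size : ∣ unforced ps ∣ + m ≤ n
      size = IsChain⇒∣unforced∣ ps chain
      zf : ZeroForcingSet (complement G) (unforced ps)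
      zf = IsChain⇒ZeroForcingSet ps chain
      lower : ∀ B → ZeroForcingSet (complement G) B → n ∸ m ≤ ∣ B ∣
      lower B zfB = ≮⇒≥ λ lt → maximal (ZeroForcingSet⇒Chain zfB
        (subst (_≤ n) (sym (+-suc ∣ B ∣ m)) (m≤o∸n⇒m+n≤o _ (m+n≤o⇒n≤o _ size) lt)))

  -- Triangles and 4-cycles.

  triangle : ∀ {x y z} → E G x y → E G y z → E G z x → Cycle G
  triangle {x} {y} {z} xy yz zx = record
    { len = 3 ; len≥3 = ≤-refl ; vert = lookup (x ∷ y ∷ z ∷ [])
    ; inj = lookup-injective ((E⇒≢ xy ∷ E⇒≢ zx ∘ sym ∷ []) ∷ (E⇒≢ yz ∷ []) ∷ [] ∷ [])
    ; closed = cl }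
    where
      cl : ∀ i j → Consec 3 i j → E G (lookup (x ∷ y ∷ z ∷ []) i) (lookup (x ∷ y ∷ z ∷ []) j)
      -- Functionality of `Consec` identifies `j` with the known successor, which avoids splitting
      -- on `j`.
      cl zero             j p with refl ← Consec-functional {j′ = suc zero}       p (inj₁ refl) = xy
      cl (suc zero)       j p with refl ← Consec-functional {j′ = suc (suc zero)} p (inj₁ refl) = yz
      cl (suc (suc zero)) j p with refl ← Consec-functional {j′ = zero} p (inj₂ (refl , refl)) = zx

  -- Only opposite corners need an inequality; adjacent ones differ since there are no loops. Named
  -- corners make the symmetries of the 4-cycle immediate.
  record Square (a b c d : Fin n) : Set where
    field
      ab  : E G a b
      bc  : E G b c
      cd  : E G c d
      da  : E G d a
      a≢c : a ≢ c
      b≢d : b ≢ d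

  rotate : ∀ {a b c d} → Square a b c d → Square b c d a
  rotate s = record { ab = bc ; bc = cd ; cd = da ; da = ab ; a≢c = b≢d ; b≢d = a≢c ∘ sym }
    where open Square s

  reflect : ∀ {a b c d} → Square a b c d → Square a d c b
  reflect s = record { ab = E-sym da ; bc = E-sym cd ; cd = E-sym bc ; da = E-sym ab
                     ; a≢c = a≢c ; b≢d = b≢d ∘ sym }
    where open Square s

  square : ∀ {a b c d} → Square a b c d → Cycle G
  square {a} {b} {c} {d} s = record
    { len = 4 ; len≥3 = n≤1+n 3 ; vert = lookup abcd
    ; inj = lookup-injective ((E⇒≢ ab ∷ a≢c ∷ E⇒≢ da ∘ sym ∷ []) ∷ (E⇒≢ bc ∷ b≢d ∷ []) ∷ (E⇒≢ cd ∷ []) ∷ [] ∷ [])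
    ; closed = cl }
    where
      open Square s
      abcd : Vec (Fin n) 4
      abcd = a ∷ b ∷ c ∷ d ∷ []
      cl : ∀ i j → Consec 4 i j → E G (lookup abcd i) (lookup abcd j)
      cl zero                   j p with refl ← Consec-functional {j′ = suc zero}             p (inj₁ refl) = ab
      cl (suc zero)             j p with refl ← Consec-functional {j′ = suc (suc zero)}       p (inj₁ refl) = bc
      cl (suc (suc zero))       j p with refl ← Consec-functional {j′ = suc (suc (suc zero))} p (inj₁ refl) = cd
      cl (suc (suc (suc zero))) j p with refl ← Consec-functional {j′ = zero} p (inj₂ (refl , refl)) = da

  off-triangle : ∀ {x y z w} (xy : E G x y) (yz : E G y z) (zx : E G z x) →
                 x ≢ w → y ≢ w → z ≢ w → ¬ OnCycle (triangle xy yz zx) w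
  off-triangle xy yz zx x≢w y≢w z≢w (zero , p) = x≢w p
  off-triangle xy yz zx x≢w y≢w z≢w (suc zero , p) = y≢w p
  off-triangle xy yz zx x≢w y≢w z≢w (suc (suc zero) , p) = z≢w p

  off-square : ∀ {a b c d w} (s : Square a b c d) →
               a ≢ w → b ≢ w → c ≢ w → d ≢ w → ¬ OnCycle (square s) w
  off-square s a≢w b≢w c≢w d≢w (zero , p) = a≢w p
  off-square s a≢w b≢w c≢w d≢w (suc zero , p) = b≢w p
  off-square s a≢w b≢w c≢w d≢w (suc (suc zero) , p) = c≢w p
  off-square s a≢w b≢w c≢w d≢w (suc (suc (suc zero)) , p) = d≢w p

  -- Moving along a cycle and leaving it.

  OnCycle? : (C : Cycle G) → ∀ u → Dec (OnCycle C u)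
  OnCycle? C u = any? λ i → vert C i ≟ u

  -- `SameCycle` compares edges, so a vertex is carried over by the edge to its successor, in
  -- whichever direction `D` traverses it.
  SameCycle⇒OnCycle : ∀ {C D : Cycle G} → SameCycle C D → ∀ {u} → OnCycle C u → OnCycle D u
  SameCycle⇒OnCycle {C} {D} same (i , refl) with next i
  ... | j , ij with proj₁ (same _ _) (i , j , ij , inj₁ (refl , refl))
  ...   | k , _ , _ , inj₁ (p , _) = k , p
  ...   | _ , l , _ , inj₂ (_ , p) = l , p

  exit-edge : ∀ {p} {P : Pred (Fin n) p} → Decidable P → ∀ {u v} → Reach G u v → P u → ¬ P v →
              ∃₂ λ x y → P x × ¬ P y × E G x y
  exit-edge P? here Pu ¬Pv = contradiction Pu ¬Pv
  exit-edge P? (step {u} {w} uw r) Pu ¬Pv with P? w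
  ... | yes Pw = exit-edge P? r Pw ¬Pv
  ... | no ¬Pw = u , w , Pu , ¬Pw , uw

  record Arc (C : Cycle G) (i : Fin (len C)) : Set where
    field
      {j k} : Fin (len C)
      ij  : E G (vert C i) (vert C j)
      jk  : E G (vert C j) (vert C k)
      i≢k : vert C i ≢ vert C k

  arc : ∀ C i → Arc C i
  arc C i with j , ij ← next i with k , jk ← next j = record
    { ij = closed C _ _ ij ; jk = closed C _ _ jk
    ; i≢k = λ eq → Consec²-irreflexive (len≥3 C) ij jk (inj C _ _ eq) }

  origin : (C : Cycle G) → Fin (len C)
  origin C = fromℕ< (≤-trans (s≤s z≤n) (len≥3 C))

  -- Among three consecutive edges of a cycle, one misses `c`.
  edge-avoiding : ∀ (C : Cycle G) c → ∃₂ λ i j → E G (vert C i) (vert C j) × vert C i ≢ c × vert C j ≢ c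
  edge-avoiding C c with arc C (origin C)
  ... | record { j = j ; ij = ij ; jk = jk ; i≢k = i≢k } with vert C j ≟ c | vert C (origin C) ≟ c
  ... | no j≢c | no i≢c = _ , j , ij , i≢c , j≢c
  ... | no j≢c | yes refl = j , _ , jk , j≢c , i≢k ∘ sym
  ... | yes refl | _ with arc C j
  ...   | record { ij = jk ; jk = kl ; i≢k = j≢l } = _ , _ , kl , E⇒≢ jk ∘ sym , j≢l ∘ sym

  -- Vertices adjacent to all others, and stars plus matchings.

  Universal : Fin n → Set
  Universal c = ∀ v → v ≢ c → E G c v

  Universal? : Decidable Universal
  Universal? c = all? λ v → ¬? (v ≟ c) →-dec E? c v

  ¬Universal⇒NonEdge : ∀ {c} → ¬ Universal c → ∃ λ v → NonEdge (c , v)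
  ¬Universal⇒NonEdge {c} ¬univ
    with v , ¬p ← ¬∀⟶∃¬ n (λ v → v ≢ c → E G c v) (λ v → ¬? (v ≟ c) →-dec E? c v) ¬univ
    = v , (λ c≡v → ¬p λ v≢c → contradiction (sym c≡v) v≢c) , λ cv → ¬p λ _ → cv

  -- `a′` is adjacent to neither `a` nor `b`, since the leaf-neighbour of `a` is `b` and that of
  -- `a′` is `b′`.
  Star⇒Chain2 : StarPlusMatching G → Chain 2
  Star⇒Chain2 (c , _ , matching , a , b , a′ , b′ , a≢c , b≢c , a′≢c , b′≢c , ab , a′b′ , a≢a′ , a≢b′ , b≢a′ , b≢b′) =
    (a , a′) ∷ (a′ , b) ∷ [] ,
    ((a≢a′ , λ aa′ → b≢a′ (matching a b a′ a≢c b≢c a′≢c ab aa′)) ∷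
     (b≢a′ ∘ sym , λ a′b → b≢b′ (matching a′ b b′ a′≢c b≢c b′≢c a′b a′b′)) ∷ []) ,
    (ab ∷ []) ∷ [] ∷ []

  -- The centre has no non-neighbour, so every chain entry is a leaf. Then the leaf-neighbours `v₂`
  -- and `v₃` of `u₁` coincide, yet `u₂` is adjacent only to the latter.
  Star⇒¬Chain3 : StarPlusMatching G → ¬ Chain 3
  Star⇒¬Chain3 (c , univ , matching , _)
    ((u₁ , v₁) ∷ (u₂ , v₂) ∷ (u₃ , v₃) ∷ [] , (ne₁ ∷ ne₂ ∷ ne₃ ∷ []) , (u₁v₂ ∷ u₁v₃ ∷ []) ∷ (u₂v₃ ∷ []) ∷ _) =
    neighbour-distinctʳ u₂v₃ (proj₂ ne₂) (sym (matching u₁ v₂ v₃ (≢cˡ ne₁) (≢cʳ ne₂) (≢cʳ ne₃) u₁v₂ u₁v₃))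
    where
      ≢cˡ : ∀ {u v} → NonEdge (u , v) → u ≢ c
      ≢cˡ (u≢v , ¬uv) refl = ¬uv (univ _ (u≢v ∘ sym))
      ≢cʳ : ∀ {u v} → NonEdge (u , v) → v ≢ c
      ≢cʳ (u≢v , ¬uv) refl = ¬uv (E-sym (univ _ u≢v))

  -- Configurations that a cactus excludes.

  module _ (cactus : Cactus G) where

    -- Distinctness of the cycles is witnessed by a vertex of `C` off `D`.
    meet-once : ∀ (C D : Cycle G) {w u v} → OnCycle C w → ¬ OnCycle D w →
                OnCycle C u → OnCycle D u → OnCycle C v → OnCycle D v → u ≡ v
    meet-once C D w∈C w∉D u∈C u∈D v∈C v∈D =
      proj₂ cactus C D (λ same → w∉D (SameCycle⇒OnCycle {C} {D} same w∈C)) _ _ u∈C u∈D v∈C v∈D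

    -- Otherwise two different triangles share the edge `x y`.
    no-diamond : ∀ {x y z z′} → E G x y → E G y z → E G z x → E G y z′ → E G z′ x → z ≡ z′
    no-diamond {z = z} {z′} xy yz zx yz′ z′x with z ≟ z′
    ... | yes z≡z′ = z≡z′
    ... | no z≢z′ = contradiction
      (meet-once (triangle xy yz zx) (triangle xy yz′ z′x) (suc (suc zero) , refl)
        (off-triangle xy yz′ z′x (E⇒≢ zx ∘ sym) (E⇒≢ yz) (z≢z′ ∘ sym))
        (zero , refl) (zero , refl) (suc zero , refl) (suc zero , refl))
      (E⇒≢ xy)

    no-chord : ∀ {a b c d} → Square a b c d → ¬ E G a c
    no-chord s ac = Square.b≢d s (no-diamond (E-sym ac) ab bc (E-sym da) (E-sym cd))
      where open Square s

    -- Replacing the corner `d` by `x` would give a second 4-cycle through `a` and `c`.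
    no-third-common-neighbour : ∀ {a b c d x} → Square a b c d → E G a x → E G c x → x ≢ b → ¬ (x ≢ d)
    no-third-common-neighbour {a} {b} {c} {d} {x} s ax cx x≢b x≢d = a≢c
      (meet-once (square s) (square s′) (suc (suc (suc zero)) , refl)
        (off-square s′ (E⇒≢ da ∘ sym) b≢d (E⇒≢ cd) x≢d)
        (zero , refl) (zero , refl) (suc (suc zero) , refl) (suc (suc zero) , refl))
      where
        open Square s using (ab; bc; cd; da; a≢c; b≢d)
        s′ : Square a b c x
        s′ = record { ab = ab ; bc = bc ; cd = cx ; da = E-sym ax ; a≢c = a≢c ; b≢d = x≢b ∘ sym }

    -- Chains of length 5 and 4 in a cactus.

    ¬Chain5 : ¬ Chain 5
    ¬Chain5 ((u₁ , v₁) ∷ (u₂ , v₂) ∷ (u₃ , v₃) ∷ (u₄ , v₄) ∷ (u₅ , v₅) ∷ [] ,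
             (_ ∷ (_ , ¬u₂v₂) ∷ (_ , ¬u₃v₃) ∷ (_ , ¬u₄v₄) ∷ _ ∷ []) ,
             (u₁v₂ ∷ u₁v₃ ∷ u₁v₄ ∷ u₁v₅ ∷ []) ∷ (u₂v₃ ∷ u₂v₄ ∷ u₂v₅ ∷ []) ∷ (u₃v₄ ∷ u₃v₅ ∷ []) ∷ (u₄v₅ ∷ []) ∷ _) =
      no-third-common-neighbour s u₁v₅ u₂v₅ (neighbour-distinctʳ u₃v₅ ¬u₃v₃) (neighbour-distinctʳ u₄v₅ ¬u₄v₄)
      where
        s : Square u₁ v₃ u₂ v₄
        s = record { ab = u₁v₃ ; bc = E-sym u₂v₃ ; cd = u₂v₄ ; da = E-sym u₁v₄
                   ; a≢c = neighbour-distinctˡ u₁v₂ ¬u₂v₂ ; b≢d = neighbour-distinctʳ u₃v₄ ¬u₃v₃ ∘ sym }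

    Chain4⇒FourCycleCond : Chain 4 → FourCycleCond G
    Chain4⇒FourCycleCond
      ((u₁ , v₁) ∷ (u₂ , v₂) ∷ (u₃ , v₃) ∷ (u₄ , v₄) ∷ [] ,
       (_ ∷ (u₂≢v₂ , ¬u₂v₂) ∷ (u₃≢v₃ , ¬u₃v₃) ∷ _ ∷ []) ,
       (u₁v₂ ∷ u₁v₃ ∷ u₁v₄ ∷ []) ∷ (u₂v₃ ∷ u₂v₄ ∷ []) ∷ (u₃v₄ ∷ []) ∷ _) =
      square s , refl , zero , suc zero , u₁v₄ ,
      -- `v₂` is off the cycle because `u₂` is adjacent to `v₃` and `v₄` but not to it; `u₃` is off
      -- because, unlike `u₁` and `u₂`, it is not adjacent to `v₃`.
      (v₂ , off-square s (E⇒≢ u₁v₂) (neighbour-distinctʳ u₂v₄ ¬u₂v₂) u₂≢v₂ (neighbour-distinctʳ u₂v₃ ¬u₂v₂) , u₁v₂) ,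
      (u₃ , off-square s (neighbour-distinctˡ u₁v₃ ¬u₃v₃) (E⇒≢ u₃v₄ ∘ sym) (neighbour-distinctˡ u₂v₃ ¬u₃v₃) (u₃≢v₃ ∘ sym) , E-sym u₃v₄)
      where
        s : Square u₁ v₄ u₂ v₃
        s = record { ab = u₁v₄ ; bc = E-sym u₂v₄ ; cd = u₂v₃ ; da = E-sym u₁v₃
                   ; a≢c = neighbour-distinctˡ u₁v₂ ¬u₂v₂ ; b≢d = neighbour-distinctʳ u₃v₄ ¬u₃v₃ }

    Square⇒Chain4 : ∀ {a b c d x y} → Square a b c d → E G a x → E G b y →
                    b ≢ x → c ≢ x → d ≢ x → a ≢ y → c ≢ y → d ≢ y → Chain 4
    Square⇒Chain4 {a} {b} {c} {d} {x} {y} s ax by b≢x c≢x d≢x a≢y c≢y d≢y =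
      -- The outer pairs are the diagonals. An edge `c x` would make `x` a third common neighbour of
      -- `a` and `c`; likewise `y d` for `b` and `d`.
      (a , c) ∷ (c , x) ∷ (y , d) ∷ (d , b) ∷ [] ,
      ((a≢c , no-chord s) ∷
       (c≢x , λ cx → no-third-common-neighbour s ax cx (b≢x ∘ sym) (d≢x ∘ sym)) ∷
       (d≢y ∘ sym , λ yd → no-third-common-neighbour (rotate s) by (E-sym yd) (c≢y ∘ sym) (a≢y ∘ sym)) ∷
       (b≢d ∘ sym , no-chord (rotate s) ∘ E-sym) ∷ []) ,
      (ax ∷ E-sym da ∷ ab ∷ []) ∷ (cd ∷ E-sym bc ∷ []) ∷ (E-sym by ∷ []) ∷ [] ∷ []
      where open Square s

    FourCycleCond⇒Chain4 : FourCycleCond G → Chain 4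
    FourCycleCond⇒Chain4 (record { vert = v ; inj = v-inj ; closed = v-closed } , refl , i , j , vij , (x , x∉ , vix) , (y , y∉ , vjy)) =
      go i j vij vix vjy
      where
        c₀ c₁ c₂ c₃ : Fin 4
        c₀ = zero
        c₁ = suc zero
        c₂ = suc (suc zero)
        c₃ = suc (suc (suc zero))

        s : Square (v c₀) (v c₁) (v c₂) (v c₃)
        s = record { ab = v-closed c₀ c₁ (inj₁ refl) ; bc = v-closed c₁ c₂ (inj₁ refl)
                   ; cd = v-closed c₂ c₃ (inj₁ refl) ; da = v-closed c₃ c₀ (inj₂ (refl , refl))
                   ; a≢c = λ eq → contradiction (v-inj c₀ c₂ eq) λ ()
                   ; b≢d = λ eq → contradiction (v-inj c₁ c₃ eq) λ () }

        side : ∀ {a b c d} → Square (v a) (v b) (v c) (v d) → E G (v a) x → E G (v b) y → Chain 4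
        side s ax by = Square⇒Chain4 s ax by
          (λ e → x∉ (_ , e)) (λ e → x∉ (_ , e)) (λ e → x∉ (_ , e))
          (λ e → y∉ (_ , e)) (λ e → y∉ (_ , e)) (λ e → y∉ (_ , e))

        s₁ = rotate s
        s₂ = rotate s₁
        s₃ = rotate s₂

        -- The positions `i` and `j` are only known to be adjacent in `G`. Diagonals are excluded as
        -- chords; each remaining case is a side, moved to the first position by a symmetry.
        go : ∀ i j → E G (v i) (v j) → E G (v i) x → E G (v j) y → Chain 4
        go zero zero e = contradiction refl (E⇒≢ e)
        go zero (suc zero) _ = side s
        go zero (suc (suc zero)) e = contradiction e (no-chord s)
        go zero (suc (suc (suc zero))) _ = side (reflect s)
        go (suc zero) zero _ = side (reflect s₁)
        go (suc zero) (suc zero) e = contradiction refl (E⇒≢ e)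
        go (suc zero) (suc (suc zero)) _ = side s₁
        go (suc zero) (suc (suc (suc zero))) e = contradiction e (no-chord s₁)
        go (suc (suc zero)) zero e = contradiction e (no-chord s₂)
        go (suc (suc zero)) (suc zero) _ = side (reflect s₂)
        go (suc (suc zero)) (suc (suc zero)) e = contradiction refl (E⇒≢ e)
        go (suc (suc zero)) (suc (suc (suc zero))) _ = side s₂
        go (suc (suc (suc zero))) zero _ = side s₃
        go (suc (suc (suc zero))) (suc zero) e = contradiction e (no-chord s₃)
        go (suc (suc (suc zero))) (suc (suc zero)) _ = side (reflect s₃)
        go (suc (suc (suc zero))) (suc (suc (suc zero))) e = contradiction refl (E⇒≢ e)

    -- Consequences of having two cycles.

    module _ (two : AtLeastTwoCycles G) where

      private
        C = proj₁ two
        D = proj₁ (proj₂ two)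

        C∩D : ∀ {u v} → OnCycle C u → OnCycle D u → OnCycle C v → OnCycle D v → u ≡ v
        C∩D = proj₂ cactus C D (proj₂ (proj₂ two)) _ _

      -- Each of the two cycles has an edge missing `c`, and these are the two leaf edges. Two leaf
      -- edges at one vertex `v` would lie in two triangles on the edge `c v`.
      Universal⇒Star : ∀ {c} → Universal c → StarPlusMatching G
      Universal⇒Star {c} univ
        with i , j , ab , a≢c , b≢c ← edge-avoiding C c
        with i′ , j′ , a′b′ , a′≢c , b′≢c ← edge-avoiding D c
        = c , univ , matching , _ , _ , _ , _ , a≢c , b≢c , a′≢c , b′≢c , ab , a′b′ ,
          (λ eq → disjoint ab a′b′ a≢c b≢c b′≢c eq) ,
          (λ eq → disjoint ab (E-sym a′b′) a≢c b≢c a′≢c eq) ,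
          (λ eq → disjoint (E-sym ab) a′b′ b≢c a≢c b′≢c eq) ,
          (λ eq → disjoint (E-sym ab) (E-sym a′b′) b≢c a≢c a′≢c eq)
        where
          matching : ∀ v w w′ → v ≢ c → w ≢ c → w′ ≢ c → E G v w → E G v w′ → w ≡ w′
          matching v w w′ v≢c w≢c w′≢c vw vw′ =
            no-diamond (univ v v≢c) vw (E-sym (univ w w≢c)) vw′ (E-sym (univ w′ w′≢c))

          -- Two leaf edges meeting in a vertex coincide, and then C and D share both ends.
          disjoint : ∀ {i j i′ j′} → E G (vert C i) (vert C j) → E G (vert D i′) (vert D j′) →
                     vert C i ≢ c → vert C j ≢ c → vert D j′ ≢ c → vert C i ≢ vert D i′
          disjoint {i} {j} {i′} {j′} ab a′b′ a≢c b≢c b′≢c a≡a′ =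
            E⇒≢ ab (C∩D (i , refl) (i′ , sym a≡a′) (j , refl) (j′ , sym b≡b′))
            where
              b≡b′ = matching (vert C i) (vert C j) (vert D j′) a≢c b≢c b′≢c ab
                       (subst (λ a → E G a (vert D j′)) (sym a≡a′) a′b′)

      -- An edge of `D` cannot have both ends on `C`.
      ∃-off-C : ∃ λ x → ¬ OnCycle C x
      ∃-off-C with arc D (origin D)
      ... | record { j = j ; ij = ij } with OnCycle? C (vert D (origin D)) | OnCycle? C (vert D j)
      ... | no off | _ = _ , off
      ... | yes _ | no off = _ , off
      ... | yes on | yes on′ = contradiction (C∩D on (_ , refl) on′ (_ , refl)) (E⇒≢ ij)

      ¬Universal⇒Chain3 : (∀ c → ¬ Universal c) → Chain 3
      ¬Universal⇒Chain3 ¬univ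
        with x , x∉C ← ∃-off-C
        with _ , w , (i , refl) , w∉C , iw ← exit-edge (OnCycle? C) (proj₁ cactus (vert C (origin C)) x) (_ , refl) x∉C
        with arc C i
      ... | record { j = j ; k = k ; ij = ij ; jk = jk ; i≢k = i≢k }
        with p , j≢p , ¬jp ← ¬Universal⇒NonEdge (¬univ (vert C j))
        with q , i≢q , ¬iq ← ¬Universal⇒NonEdge (¬univ (vert C i))
        -- The path is w, i, j, k, with w outside `C`; `p` and `q` are arbitrary non-neighbours of
        -- its inner vertices j and i.
        = (vert C j , p) ∷ (w , vert C k) ∷ (q , vert C i) ∷ [] ,
          ((j≢p , ¬jp) ∷ (w≢k , ¬wk) ∷ (i≢q ∘ sym , ¬iq ∘ E-sym) ∷ []) ,
          (jk ∷ E-sym ij ∷ []) ∷ (E-sym iw ∷ []) ∷ [] ∷ []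
        where
          w≢k : w ≢ vert C k
          w≢k refl = w∉C (k , refl)

          -- Such an edge would close a 4-cycle through w that meets `C` in both i and j.
          ¬wk : ¬ E G w (vert C k)
          ¬wk wk = E⇒≢ ij (meet-once (square s) C (zero , refl) w∉C
                     (suc zero , refl) (i , refl) (suc (suc zero) , refl) (j , refl))
            where
              s : Square w (vert C i) (vert C j) (vert C k)
              s = record { ab = E-sym iw ; bc = ij ; cd = jk ; da = E-sym wk
                         ; a≢c = λ { refl → w∉C (j , refl) } ; b≢d = i≢k }

-- The three values of the zero forcing number.

Classification : ∀ {n} → Graph n → Set
Classification {n} G = Σ ℕ λ k → IsZ (complement G) k
  × (n ∸ 4 ≤ k) × (k ≤ n ∸ 2)
  × ((k ≡ n ∸ 2) ⇔ StarPlusMatching G)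
  × ((k ≡ n ∸ 4) ⇔ FourCycleCond G)
  × ((k ≡ n ∸ 3) ⇔ (¬ StarPlusMatching G × ¬ FourCycleCond G))

module _ {m : ℕ} (G : Graph (4 + m)) (cactus : Cactus G) where

  Star⇒Classification : StarPlusMatching G → Classification G
  Star⇒Classification star =
    -- With n written as `4 + m` the truncated subtractions compute, so `λ ()` refutes the
    -- equalities with the other two values.
    2 + m , longest-Chain⇒IsZ G (Star⇒Chain2 G star) (Star⇒¬Chain3 G star) , m≤n+m m 2 , ≤-refl ,
    mk⇔ (λ _ → star) (λ _ → refl) ,
    mk⇔ (λ ()) (λ fc → contradiction (Chain-tail G (FourCycleCond⇒Chain4 G cactus fc)) (Star⇒¬Chain3 G star)) ,
    mk⇔ (λ ()) (λ (¬star , _) → contradiction star ¬star)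

  Chain4⇒Classification : Chain G 4 → Classification G
  Chain4⇒Classification chain4 =
    m , longest-Chain⇒IsZ G chain4 (¬Chain5 G cactus) , ≤-refl , m≤n+m m 2 ,
    mk⇔ (λ ()) (λ star → contradiction (Chain-tail G chain4) (Star⇒¬Chain3 G star)) ,
    mk⇔ (λ _ → Chain4⇒FourCycleCond G cactus chain4) (λ _ → refl) ,
    mk⇔ (λ ()) (λ (_ , ¬fc) → contradiction (Chain4⇒FourCycleCond G cactus chain4) ¬fc)

  Chain3⇒Classification : Chain G 3 → ¬ Chain G 4 → Classification G
  Chain3⇒Classification chain3 ¬chain4 =
    1 + m , longest-Chain⇒IsZ G chain3 ¬chain4 , m≤n+m m 1 , n≤1+n (1 + m) ,
    mk⇔ (λ ()) (λ star → contradiction chain3 (Star⇒¬Chain3 G star)) ,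
    mk⇔ (λ ()) (λ fc → contradiction (FourCycleCond⇒Chain4 G cactus fc) ¬chain4) ,
    mk⇔ (λ _ → (λ star → Star⇒¬Chain3 G star chain3) , (λ fc → ¬chain4 (FourCycleCond⇒Chain4 G cactus fc)))
        (λ _ → refl)

theorem4p10 : (n : ℕ) → 4 ≤ n → (G : Graph n) → Cactus G → AtLeastTwoCycles G →
    Σ ℕ λ k → IsZ (complement G) k
    × (n ∸ 4 ≤ k) × (k ≤ n ∸ 2)
    × ((k ≡ n ∸ 2) ⇔ StarPlusMatching G)
    × ((k ≡ n ∸ 4) ⇔ FourCycleCond G)
    × ((k ≡ n ∸ 3) ⇔ (¬ StarPlusMatching G × ¬ FourCycleCond G))
theorem4p10 (suc (suc (suc (suc m)))) (s≤s (s≤s (s≤s (s≤s z≤n)))) G cactus two =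
  -- A vertex adjacent to all others puts `G` in case (1). Otherwise a chain of length 3 exists, and
  -- the search for one of length 4 separates n - 4 from n - 3.
  case any? (Universal? G) of λ where
    (yes (c , univ)) → Star⇒Classification G cactus (Universal⇒Star G cactus two univ)
    (no ¬univ) → case Chain? G 4 of λ where
      (yes chain4) → Chain4⇒Classification G cactus chain4
      (no ¬chain4) → Chain3⇒Classification G cactus
        (¬Universal⇒Chain3 G cactus two (λ c univ → ¬univ (c , univ))) ¬chain4
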